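{- (1) If $L\subseteq A^*$ is accepted by a nondeterministic finite automaton having depth $m$, then ${\uparrow}L$ is $m$-PT while ${\uparrow}_<L$ and $\min(L)$ are $(m+1)$-PT. (2) The same conclusions hold if $L$ is accepted by a context-free grammar, with $m=\ell^N$, where $N$ is the number of nonterminal symbols and $\ell$ is the maximum length of the right-hand sides of the production rules.
   Context: The depth of an automaton is the maximum length of a simple (non-repeating) path from an initial state to some final state. $u\sqsubseteq v$ (subword) means $u=a_1\cdots a_n$ with letters $a_i$ and $v=v_0a_1v_1\cdots a_nv_n$; $u\sqsubset v$ means $u\sqsubseteq v$ and $u\ne v$. ${\uparrow}L=\{v~|~\exists u\in L: u\sqsubseteq v\}$, ${\uparrow}_<L=\{v~|~\exists u\in L:u\sqsubset v\}$, $\min(L)=\{u\in L~|~\forall v\in L: v\not\sqsubset u\}$. $u\sim_n v$ iff $u,v$ have the same subwords of length at most $n$; $L$ is $n$-PT if it is a union of $\sim_n$-classes. -}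

module Defs where

open import Data.Fin.Base using (Fin)
import Data.Fin.Subset as Subset
open import Data.List.Base using (List; []; _∷_; _++_; length; map)
open import Data.List.Extrema.Nat using (max)
open import Data.List.Membership.Propositional renaming (_∈_ to _∈ˡ_)
open import Data.List.Relation.Binary.Sublist.Propositional using (_⊆_)
open import Data.List.Relation.Unary.Unique.Propositional using (Unique)
open import Data.Nat.Base using (ℕ; _≤_)
open import Data.Product.Base using (Σ-syntax; ∃-syntax; _×_; _,_; proj₂)
open import Data.Sum.Base using (_⊎_; inj₁; inj₂)
open import Function.Bundles using (_⇔_)
open import Level using (0ℓ)
open import Relation.Binary.Construct.Closure.ReflexiveTransitive using (Star)
open import Relation.Binary.PropositionalEquality.Core using (_≡_; _≢_)
open import Relation.Nullary.Negation.Core using (¬_)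
open import Relation.Unary using (Pred; _∈_; _≐_; ⋃)

Word : ℕ → Set
Word k = List (Fin k)

Language : ℕ → Set₁
Language k = Pred (Word k) 0ℓ

private variable
  k : ℕ

infix 4 _⊑_ _⊏_ _∼[_]_

_⊑_ : Word k → Word k → Set
_⊑_ = _⊆_

_⊏_ : Word k → Word k → Set
u ⊏ v = u ⊑ v × u ≢ v

↑_ : Language k → Language k
(↑ L) v = ∃[ u ] u ∈ L × u ⊑ v

↑<_ : Language k → Language k
(↑< L) v = ∃[ u ] u ∈ L × u ⊏ v

minL : Language k → Language k
minL L u = u ∈ L × (∀ v → v ∈ L → ¬ (v ⊏ u))

_∼[_]_ : Word k → ℕ → Word k → Set
u ∼[ n ] v = ∀ w → length w ≤ n → (w ⊑ u ⇔ w ⊑ v)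

class : ℕ → Word k → Language k
class n u v = u ∼[ n ] v

infix 4 _-PT_

-- The classes in the union are given by a family of representatives.
_-PT_ : ℕ → Language k → Set₁
n -PT L = Σ[ I ∈ Set ] Σ[ r ∈ (I → Word _) ] L ≐ ⋃ I (λ i → class n (r i))

record NFA (k : ℕ) : Set where
  field
    states  : ℕ
    initial : Subset.Subset states
    final   : Subset.Subset states
    δ       : Fin states → Fin k → Subset.Subset states

  State : Set
  State = Fin states

  data Path (p : State) : Word k → State → Set where
    []   : Path p [] p
    step : ∀ {q r w} a → q Subset.∈ δ p a → Path q w r → Path p (a ∷ w) r

  visited : ∀ {p w q} → Path p w q → List State
  visited {p} []           = p ∷ []
  visited {p} (step _ _ π) = p ∷ visited π

  pathLength : ∀ {p w q} → Path p w q → ℕ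
  pathLength []           = 0
  pathLength (step _ _ π) = ℕ.suc (pathLength π)

  Simple : ∀ {p w q} → Path p w q → Set
  Simple π = Unique (visited π)

  accepted : Language k
  accepted w = ∃[ p ] ∃[ q ] p Subset.∈ initial × q Subset.∈ final × Path p w q

  SimplePathOfLength : ℕ → Set
  SimplePathOfLength n =
    ∃[ p ] ∃[ q ] ∃[ w ] p Subset.∈ initial × q Subset.∈ final ×
      Σ[ π ∈ Path p w q ] Simple π × pathLength π ≡ n

  -- `none` is the convention that the maximum of the empty set of lengths is 0.
  data HasDepth : ℕ → Set where
    maximum : ∀ {m} → SimplePathOfLength m →
              (∀ n → SimplePathOfLength n → n ≤ m) → HasDepth m
    none    : (∀ n → ¬ SimplePathOfLength n) → HasDepth 0

record CFG (k : ℕ) : Set where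
  field
    nonterminals : ℕ

  Nonterminal : Set
  Nonterminal = Fin nonterminals

  SententialForm : Set
  SententialForm = List (Nonterminal ⊎ Fin k)

  field
    start : Nonterminal
    rules : List (Nonterminal × SententialForm)

  data _⇒_ : SententialForm → SententialForm → Set where
    rewriteAt : ∀ α {X γ} β → (X , γ) ∈ˡ rules →
                (α ++ inj₁ X ∷ β) ⇒ (α ++ γ ++ β)

  _⇒*_ : SententialForm → SententialForm → Set
  _⇒*_ = Star _⇒_

  generated : Language k
  generated w = (inj₁ start ∷ []) ⇒* map inj₂ w

  -- 0 if there are no rules.
  maxRhsLength : ℕ
  maxRhsLength = max 0 (map (λ rule → length (proj₂ rule)) rules)

{-# OPTIONS --safe #-}

-- Every automaton of depth m, and every grammar with m = ℓ ^ N, satisfies that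
-- each word of L has a subword of length at most m in L: cut the loops out of
-- an accepting path, respectively replace a subtree of a parse tree by a lower
-- one with the same root.  Hence ↑ L is determined by the subwords of length at
-- most m.  For ↑< L and min L, one more letter suffices to tell a word of
-- length at most m from all its proper superwords.
module Submission where

open import Defs
open import Data.Empty using (⊥-elim)
open import Data.Fin.Properties using (_≟_)
open import Data.Fin.Subset as Subset using (Subset; ⊤; _-_; ∣_∣)
open import Data.Fin.Subset.Properties
  using (∈⊤; ∣⊤∣≡n; p─q⊆p; x∈p⇒∣p-x∣<∣p∣; x∈p∧x≢y⇒x∈p-y)
open import Data.List.Base using ([]; _∷_; _++_; length; map)
open import Data.List.Extrema.Nat using (xs≤max)
open import Data.List.Membership.DecPropositional using (_∈?_)
open import Data.List.Membership.Propositional renaming (_∈_ to _∈ˡ_)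
open import Data.List.Membership.Propositional.Properties using (∈-map⁺)
open import Data.List.Properties using (≡-dec; ++-assoc; ++-identityʳ; map-++; length-++)
open import Data.List.Relation.Binary.Sublist.Propositional
  using ([]; _∷_; _∷ʳ_; ⊆-refl; ⊆-trans; ⊆-antisym)
open import Data.List.Relation.Binary.Sublist.Propositional.Properties
  using (++⁺; ++⁺ˡ; ++⁺ʳ; length-mono-≤)
import Data.List.Relation.Unary.All as All
open import Data.List.Relation.Unary.All.Properties using (¬Any⇒All¬)
open import Data.List.Relation.Unary.AllPairs using ([]; _∷_)
open import Data.List.Relation.Unary.Any using (here; there)
open import Data.Nat.Base using (ℕ; zero; suc; _*_; _^_; _≤_; z≤n; s≤s; s≤s⁻¹; >-nonZero)
open import Data.Nat.Properties
  using (≤-trans; ≤-reflexive; <⇒≱; n≤1+n; m≤n⇒m≤1+n; <-≤-trans;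
         +-mono-≤; *-monoˡ-≤; m^n>0)
open import Data.Product.Base using (Σ-syntax; ∃-syntax; _×_; _,_; proj₁; proj₂)
open import Data.Sum.Base using (_⊎_; inj₁; inj₂)
open import Function.Bundles using (mk⇔; module Equivalence)
open import Relation.Binary.Construct.Closure.ReflexiveTransitive using (ε; _◅_; _◅◅_; gmap)
open import Relation.Binary.PropositionalEquality
  using (_≡_; refl; sym; trans; cong; subst; subst₂)
open import Relation.Nullary using (yes; no)
open import Relation.Unary using (_∈_; _≐_)

private variable
  k m n : ℕ
  u v w : Word k

-- Piecewise testability from short subwords

∼-refl : u ∼[ n ] u
∼-refl w _ = mk⇔ (λ s → s) (λ s → s)

-- Each word of `L` represents its own class, so reflexivity gives one inclusion and closure the
-- other.
∼-closed⇒-PT : (L : Language k) → (∀ {u v} → u ∈ L → u ∼[ n ] v → v ∈ L) → n -PT L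
∼-closed⇒-PT L closed =
  (∃[ u ] u ∈ L) , proj₁ ,
  (λ v∈L → (_ , v∈L) , ∼-refl) , (λ ((_ , u∈L) , u∼v) → closed u∈L u∼v)

-- The first letter of `v` that the embedding skips can be inserted into `u`; if none is skipped,
-- the words agree.
⊑-grow : u ⊑ v → u ≡ v ⊎ ∃[ w ] w ⊑ v × length w ≡ suc (length u)
⊑-grow []         = inj₁ refl
⊑-grow (y ∷ʳ s)   = inj₂ (y ∷ _ , refl ∷ s , refl)
⊑-grow (refl ∷ s) with ⊑-grow s
... | inj₁ refl         = inj₁ refl
... | inj₂ (w , t , eq) = inj₂ (_ ∷ w , refl ∷ t , cong suc eq)

-- Otherwise `u` grows by one letter inside `v`; the grown word has length at most `suc n`, so it
-- would be a subword of the shorter `u`.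
short-⊑⇒≡ : length u ≤ n → u ⊑ v → (∀ w → length w ≤ suc n → w ⊑ v → w ⊑ u) → u ≡ v
short-⊑⇒≡ u≤n u⊑v sub with ⊑-grow u⊑v
... | inj₁ u≡v            = u≡v
... | inj₂ (w , w⊑v , eq) = ⊥-elim (<⇒≱ (≤-reflexive (sym eq))
  (length-mono-≤ (sub w (≤-trans (≤-reflexive eq) (s≤s u≤n)) w⊑v)))

ShortSubwords : ℕ → Language k → Set
ShortSubwords m L = ∀ {v} → v ∈ L → ∃[ u ] u ∈ L × u ⊑ v × length u ≤ m

module _ (L : Language k) (short : ShortSubwords m L) where

  ↑-PT : m -PT (↑ L)
  ↑-PT = ∼-closed⇒-PT (↑ L) λ (u , u∈L , u⊑v) v∼v′ →
    let x , x∈L , x⊑u , x≤m = short u∈L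
    in x , x∈L , Equivalence.to (v∼v′ x x≤m) (⊆-trans x⊑u u⊑v)

  ↑<-PT : suc m -PT (↑< L)
  ↑<-PT = ∼-closed⇒-PT (↑< L) closed
    where
    closed : ∀ {v v′} → v ∈ (↑< L) → v ∼[ suc m ] v′ → v′ ∈ (↑< L)
    closed {v} {v′} (u , u∈L , u⊑v , u≢v) v∼v′ with short u∈L
    ... | x , x∈L , x⊑u , x≤m =
      x , x∈L , Equivalence.to (v∼v′ x (m≤n⇒m≤1+n x≤m)) x⊑v , x≢v′
      where
      x⊑v = ⊆-trans x⊑u u⊑v
      x≢v′ : x ≡ v′ → _
      -- If `x` were `v′`, then `v` would have no subwords of length at most `suc m` beyond those of
      -- `x`. So `x` is `v`, and `u`, lying between them, is `v` too.
      x≢v′ refl with short-⊑⇒≡ x≤m x⊑v (λ w w≤ → Equivalence.to (v∼v′ w w≤))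
      ... | refl = u≢v (⊆-antisym u⊑v x⊑u)

  minL-PT : suc m -PT (minL L)
  minL-PT = ∼-closed⇒-PT (minL L) closed
    where
    closed : ∀ {v v′} → v ∈ minL L → v ∼[ suc m ] v′ → v′ ∈ minL L
    closed {v} {v′} (v∈L , minimal) v∼v′ with short v∈L
    ... | x , x∈L , x⊑v , x≤m with ≡-dec _≟_ x v
    ...   | no x≢v   = ⊥-elim (minimal x x∈L (x⊑v , x≢v))
    -- Minimality has forced `v` to be its own short subword, so `v` embeds in `v′` and is short
    -- enough to equal it.
    ...   | yes refl = subst (minL L)
      (short-⊑⇒≡ x≤m (Equivalence.to (v∼v′ v (m≤n⇒m≤1+n x≤m)) ⊆-refl)
        (λ w w≤ → Equivalence.from (v∼v′ w w≤)))
      (v∈L , minimal)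

  all-PT : (m -PT (↑ L)) × (suc m -PT (↑< L)) × (suc m -PT (minL L))
  all-PT = ↑-PT , ↑<-PT , minL-PT

ShortSubwords-resp-≐ : {L K : Language k} → L ≐ K → ShortSubwords m K → ShortSubwords m L
ShortSubwords-resp-≐ (L⊆K , K⊆L) short v∈L =
  let u , u∈K , rest = short (L⊆K v∈L) in u , K⊆L u∈K , rest

-- Automata: cutting loops

module _ (M : NFA k) where
  open NFA M

  SimpleSubpath : State → Word k → State → Set
  SimpleSubpath p w q = ∃[ u ] u ⊑ w × Σ[ π ∈ Path p u q ] Simple π

  pathLength≡length : ∀ {p w q} (π : Path p w q) → pathLength π ≡ length w
  pathLength≡length []           = refl
  pathLength≡length (step _ _ π) = cong suc (pathLength≡length π)

  suffix-from : ∀ {p w q r} (π : Path p w q) → Simple π → r ∈ˡ visited π → SimpleSubpath r w q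
  suffix-from []             simple       (here refl) = _ , ⊆-refl , [] , simple
  suffix-from π@(step _ _ _) simple       (here refl) = _ , ⊆-refl , π , simple
  suffix-from (step a _ π)   (_ ∷ simple) (there r∈π) =
    let u , u⊑w , rest = suffix-from π simple r∈π in u , a ∷ʳ u⊑w , rest

  -- The tail is made simple first. If it returns to `p`, the path restarts at that visit, which
  -- drops `a` and all letters read before it.
  cut-loops : ∀ {p w q} → Path p w q → SimpleSubpath p w q
  cut-loops [] = [] , [] , [] , All.[] ∷ []
  cut-loops {p} (step a q∈δ π) with cut-loops π
  ... | u , u⊑w , ρ , simple with _∈?_ _≟_ p (visited ρ)
  ...   | no p∉ρ  = a ∷ u , refl ∷ u⊑w , step a q∈δ ρ , ¬Any⇒All¬ _ p∉ρ ∷ simple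
  ...   | yes p∈ρ =
    let x , x⊑u , rest = suffix-from ρ simple p∈ρ in x , a ∷ʳ ⊆-trans x⊑u u⊑w , rest

  simplePathLength≤depth : HasDepth m → SimplePathOfLength n → n ≤ m
  simplePathLength≤depth (maximum _ bound) path = bound _ path
  simplePathLength≤depth (none empty)      path = ⊥-elim (empty _ path)

  accepted-short : HasDepth m → ShortSubwords m accepted
  accepted-short depth (p , q , p∈I , q∈F , π) =
    let u , u⊑v , ρ , simple = cut-loops π
    in u , (p , q , p∈I , q∈F , ρ) , u⊑v ,
       simplePathLength≤depth depth
         (p , q , u , p∈I , q∈F , ρ , simple , pathLength≡length ρ)

-- Grammars: parse forests and derivations

module _ (G : CFG k) where
  open CFG G

  private
    variable
      S : Subset nonterminals
      X : Nonterminal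
      α β γ : SententialForm

    ℓ : ℕ
    ℓ = maxRhsLength

  -- Parse forests whose inner nodes are all labelled in S.
  data Forest (S : Subset nonterminals) : SententialForm → Word k → Set where
    []   : Forest S [] []
    leaf : ∀ a → Forest S α w → Forest S (inj₂ a ∷ α) (a ∷ w)
    node : X Subset.∈ S → (X , γ) ∈ˡ rules →
           Forest S γ u → Forest S α v → Forest S (inj₁ X ∷ α) (u ++ v)

  weaken : ∀ {S T} → S Subset.⊆ T → Forest S α w → Forest T α w
  weaken S⊆T []             = []
  weaken S⊆T (leaf a f)     = leaf a (weaken S⊆T f)
  weaken S⊆T (node X∈S r f g) = node (S⊆T X∈S) r (weaken S⊆T f) (weaken S⊆T g)

  ++-split : ∀ α → Forest S (α ++ β) w →
             ∃[ u ] ∃[ v ] w ≡ u ++ v × Forest S α u × Forest S β v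
  ++-split [] f = [] , _ , refl , [] , f
  ++-split (_ ∷ α) (leaf a f) =
    let u , v , eq , g , h = ++-split α f
    in a ∷ u , v , cong (a ∷_) eq , leaf a g , h
  ++-split (_ ∷ α) (node {u = x} X∈S r e f) =
    let u , v , eq , g , h = ++-split α f
    in x ++ u , v , trans (cong (x ++_) eq) (sym (++-assoc x u v)) , node X∈S r e g , h

  -- Undoes one derivation step: the trees over `γ` become the children of a new node labelled `X`.
  unrewrite : ∀ α → (X , γ) ∈ˡ rules →
              Forest ⊤ (α ++ γ ++ β) w → Forest ⊤ (α ++ inj₁ X ∷ β) w
  unrewrite {γ = γ} [] r f with ++-split γ f
  ... | _ , _ , refl , g , h = node ∈⊤ r g h
  unrewrite (_ ∷ α) r (leaf a f)        = leaf a (unrewrite α r f)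
  unrewrite (_ ∷ α) r (node X∈S r′ e f) = node X∈S r′ e (unrewrite α r f)

  leaves : ∀ w → Forest S (map inj₂ w) w
  leaves []      = []
  leaves (a ∷ w) = leaf a (leaves w)

  ⇒*⇒Forest : α ⇒* map inj₂ w → Forest ⊤ α w
  ⇒*⇒Forest ε                       = leaves _
  ⇒*⇒Forest (rewriteAt α β r ◅ rest) = unrewrite α r (⇒*⇒Forest rest)

  ⇒-++ˡ : ∀ γ → α ⇒ β → (γ ++ α) ⇒ (γ ++ β)
  ⇒-++ˡ γ (rewriteAt α {X} {δ} β r) =
    subst₂ _⇒_ (++-assoc γ α (inj₁ X ∷ β)) (++-assoc γ α (δ ++ β)) (rewriteAt (γ ++ α) β r)

  ⇒-++ʳ : ∀ γ → α ⇒ β → (α ++ γ) ⇒ (β ++ γ)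
  ⇒-++ʳ γ (rewriteAt α {X} {δ} β r) =
    subst₂ _⇒_ (sym (++-assoc α (inj₁ X ∷ β) γ))
      (trans (cong (α ++_) (sym (++-assoc δ β γ))) (sym (++-assoc α (δ ++ β) γ)))
      (rewriteAt α (β ++ γ) r)

  Forest⇒⇒* : Forest S α w → α ⇒* map inj₂ w
  Forest⇒⇒* []         = ε
  Forest⇒⇒* (leaf a f) = gmap (inj₂ a ∷_) (⇒-++ˡ (inj₂ a ∷ [])) (Forest⇒⇒* f)
  Forest⇒⇒* (node {u = u} {α = α} {v = v} _ r f g) =
    subst (_ ⇒*_) (sym (map-++ inj₂ u v))
      -- This is the leftmost derivation: the root is expanded, then its children down to `u`, and
      -- only then the remaining symbols.
      (rewriteAt [] α r ◅
        gmap (_++ α) (⇒-++ʳ α) (Forest⇒⇒* f) ◅◅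
        gmap (map inj₂ u ++_) (⇒-++ˡ (map inj₂ u)) (Forest⇒⇒* g))

  -- Grammars: pruning parse trees

  rhs≤ℓ : (X , γ) ∈ˡ rules → length γ ≤ ℓ
  rhs≤ℓ r = All.lookup (xs≤max 0 _) (∈-map⁺ (λ rule → length (proj₂ rule)) r)

  -- A parse tree with root `X`. Only the nodes below the root must have labels in `S`, so `S - X`
  -- expresses that `X` does not recur.
  Expansion : Subset nonterminals → Nonterminal → Word k → Set
  Expansion S X w = ∃[ γ ] (X , γ) ∈ˡ rules × Forest S γ w

  -- An X-labelled node of maximal depth has no further X below it.
  lowest-expansion : ∀ X → Forest S α w →
                     Forest (S - X) α w ⊎ ∃[ u ] u ⊑ w × Expansion (S - X) X u
  lowest-expansion X [] = inj₁ []
  lowest-expansion X (leaf a f) with lowest-expansion X f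
  ... | inj₁ f′            = inj₁ (leaf a f′)
  ... | inj₂ (u , u⊑w , e) = inj₂ (u , a ∷ʳ u⊑w , e)
  lowest-expansion X (node {X = Y} {u = x} {v = y} Y∈S r f g)
    with lowest-expansion X f | lowest-expansion X g
  ... | inj₂ (u , u⊑x , e) | _                  = inj₂ (u , ++⁺ʳ y u⊑x , e)
  ... | inj₁ _             | inj₂ (u , u⊑y , e) = inj₂ (u , ++⁺ˡ x u⊑y , e)
  ... | inj₁ f′            | inj₁ g′ with Y ≟ X
  ...   | yes refl = inj₂ (x , ++⁺ʳ y ⊆-refl , _ , r , f′)
  ...   | no Y≢X   = inj₁ (node (x∈p∧x≢y⇒x∈p-y Y∈S Y≢X) r f′ g′)

  lower-expansion : ∀ X → Expansion S X w → ∃[ u ] u ⊑ w × Expansion (S - X) X u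
  lower-expansion X (γ , r , f) with lowest-expansion X f
  ... | inj₁ f′ = _ , ⊆-refl , γ , r , f′
  ... | inj₂ e  = e

  -- After passing to a lowest `X`, the at most `ℓ` trees below the root have one label fewer at
  -- their disposal, so each yields at most a power of `ℓ` with exponent one lower. The recursion is
  -- on `n`, since the lower tree is not a structural subterm.
  prune-expansion : ∀ n → ∣ S ∣ ≤ n → X Subset.∈ S → Expansion S X w →
                    ∃[ u ] u ⊑ w × Expansion S X u × length u ≤ ℓ ^ n
  -- The bound on length α makes ℓ positive as soon as α contains a terminal.
  prune-forest : ∀ n → ∣ S ∣ ≤ n → length α ≤ ℓ → Forest S α w →
                 ∃[ u ] u ⊑ w × Forest S α u × length u ≤ length α * ℓ ^ n

  prune-expansion zero S≤0 X∈S _ = ⊥-elim (<⇒≱ (<-≤-trans (x∈p⇒∣p-x∣<∣p∣ X∈S) S≤0) z≤n)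
  prune-expansion {S = S} {X = X} (suc n) S≤1+n X∈S e =
    let u , u⊑w , γ , r , f = lower-expansion X e
        v , v⊑u , g , v≤ = prune-forest n
          (s≤s⁻¹ (<-≤-trans (x∈p⇒∣p-x∣<∣p∣ X∈S) S≤1+n)) (rhs≤ℓ r) f
    -- The pruned children avoid `X`; weakening readmits it, so that the new tree can replace the
    -- old one in a forest over `S`.
    in v , ⊆-trans v⊑u u⊑w , (γ , r , weaken (p─q⊆p S _) g) ,
       ≤-trans v≤ (*-monoˡ-≤ (ℓ ^ n) (rhs≤ℓ r))

  prune-forest n S≤n α≤ℓ [] = [] , [] , [] , z≤n
  prune-forest n S≤n α≤ℓ (leaf a f) =
    let u , u⊑w , g , u≤ = prune-forest n S≤n (≤-trans (n≤1+n _) α≤ℓ) f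
    in a ∷ u , refl ∷ u⊑w , leaf a g ,
       +-mono-≤ (m^n>0 ℓ {{>-nonZero (≤-trans (s≤s z≤n) α≤ℓ)}} n) u≤
  prune-forest n S≤n α≤ℓ (node X∈S r f g) =
    let u , u⊑x , (_ , r′ , f′) , u≤ = prune-expansion n S≤n X∈S (_ , r , f)
        v , v⊑y , g′ , v≤ = prune-forest n S≤n (≤-trans (n≤1+n _) α≤ℓ) g
    in u ++ v , ++⁺ u⊑x v⊑y , node X∈S r′ f′ g′ ,
       ≤-trans (≤-reflexive (length-++ u)) (+-mono-≤ u≤ v≤)

  generated-short : ShortSubwords (ℓ ^ nonterminals) generated
  generated-short d with ⇒*⇒Forest d
  -- A forest over the single symbol `start` is one tree followed by the empty forest, hence the
  -- trailing `[]` in the word.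
  ... | node _ r f [] =
    let u , u⊑w , (_ , r′ , f′) , u≤ =
          prune-expansion nonterminals (≤-reflexive (∣⊤∣≡n nonterminals)) ∈⊤ (_ , r , f)
    in u , subst ((inj₁ start ∷ []) ⇒*_) (cong (map inj₂) (++-identityʳ u))
             (Forest⇒⇒* (node ∈⊤ r′ f′ [])) ,
       ++⁺ʳ [] u⊑w , u≤

theorem10 : ∀ (k : ℕ) (L : Language k) →
    (∀ (M : NFA k) (m : ℕ) → L ≐ NFA.accepted M → NFA.HasDepth M m →
    (m -PT (↑ L)) × (suc m -PT (↑< L)) × (suc m -PT (minL L)))
    ×
    (∀ (G : CFG k) → L ≐ CFG.generated G →
    let m = CFG.maxRhsLength G ^ CFG.nonterminals G in
    (m -PT (↑ L)) × (suc m -PT (↑< L)) × (suc m -PT (minL L)))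
theorem10 k L =
  (λ M m L≐M depth → all-PT L (ShortSubwords-resp-≐ {K = NFA.accepted M} L≐M (accepted-short M depth))) ,
  (λ G L≐G → all-PT L (ShortSubwords-resp-≐ {K = CFG.generated G} L≐G (generated-short G)))
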